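{- Let $G=(V,E)$ be a finite graph, let $D,C\subseteq V$ with $C\cap D=\emptyset$, and let $k$ be an integer with $1\le k\le |C|$. Let $M\setminus D\subseteq C$ be the set of nodes returned by the two-phase incremental deployment algorithm (described in the context) on input $G,D,C,k$, for any way of breaking ties. Then the contribution of the returned set to the group betweenness centrality of $D$ is at least $\left(1-\frac1e\right)\approx 0.632$ of the optimum, i.e. $$GBC^{D}(M\setminus D)\;\ge\;\left(1-\frac1e\right)\cdot \max_{M'\subseteq C,\ |M'|=k} GBC^{D}(M').$$
   Context: Graphs are finite, undirected and unweighted; $d$ is the graph distance. For $s,t\in V$, $\sigma_{s,t}$ is the number of shortest paths from $s$ to $t$ (with $\sigma_{x,x}=1$). A path traverses a node if the node lies on it, and this includes the endpoints of the path. For $S\subseteq V$, $\ddot\sigma_{s,t}(S)$ is the number of shortest paths from $s$ to $t$ that traverse at least one node of $S$. The (shortest path) group betweenness centrality of $S$ is $$GBC(S)=\sum_{s,t\in V,\ s\ne t}\frac{\ddot\sigma_{s,t}(S)}{\sigma_{s,t}},$$ the sum being over ordered pairs, with pairs for which $\sigma_{s,t}=0$ contributing $0$. For $A,X\subseteq V$, the contribution of $X$ to the GBC of $A$ is $GBC^{A}(X)=GBC(A\cup X)-GBC(A)$, i.e. the total (over ordered pairs $s\neq t$) fraction of shortest paths that traverse at least one node of $X$ but no node of $A$. For a single node $v$, write $BC^{A}(v)=GBC^{A}(\{v\})$; this is also denoted $PB^{A}(v,v)$, the total fraction of shortest paths that traverse $v$ excluding those that traverse at least one node of $A$. Two-phase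 incremental deployment algorithm. Input: $G$, existing deployment $D$, candidate set $C$, number $k$ of additional nodes. First phase: starting from $M=\emptyset$, all nodes of $D$ are added to $M$, so that $M=D$. Second phase: repeat $k$ times: find $v\in C$ with maximal $BC^{M}(v)=PB^{M}(v,v)$ (with respect to the current $M$), and replace $M$ by $M\cup\{v\}$. Output: $M\setminus D$. -}

module Defs where

open import Level using (0ℓ)
open import Data.Nat as ℕ using (ℕ; zero; suc; _!; z≤n; s≤s)
import Data.Nat.Properties as ℕₚ
open import Data.Integer as ℤ using (+_; +≤+; +<+)
import Data.Integer.Properties as ℤₚ
open import Data.Rational
  using (ℚ; mkℚ; 0ℚ; 1ℚ; ½; _+_; _*_; _-_; -_; 1/_; _/_; ∣_∣; _≤_; _<_; toℚᵘ;
         positive; nonNegative; >-nonZero)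
import Data.Rational.Properties as ℚₚ
import Data.Rational.Unnormalised as ℚᵘ
import Data.Rational.Unnormalised.Properties as ℚᵘₚ
open import Data.Rational.Solver using (module +-*-Solver)
open import Data.Empty using (⊥-elim)
open import Data.Fin using (Fin; zero; suc)
import Data.Fin.Properties as Finₚ
open import Data.Fin.Subset as Subset
  using (Subset; _∪_; _─_; ⁅_⁆; _⊆_) renaming (_∈_ to _∈ₛ_; ∣_∣ to card)
open import Data.Fin.Subset.Properties using (_∈?_)
open import Data.List.Base
  using (List; []; _∷_; length; head; last; filter; map; foldr; allFin;
         cartesianProduct; cartesianProductWith; lookup)
open import Data.List.Membership.Propositional using (_∈_)
open import Data.List.Membership.Propositional.Properties
  using (∈-filter⁺; ∈-filter⁻; ∈-allFin; ∈-lookup; ∈-cartesianProductWith⁺; ∈-cartesianProductWith⁻)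
open import Data.List.Properties using (∷-injective)
open import Data.List.Relation.Unary.All as All using (all?)
open import Data.List.Relation.Unary.All.Properties using (¬Any⇒All¬)
open import Data.List.Relation.Unary.Any using (Any; any?; here; there)
open import Data.List.Relation.Unary.AllPairs using ([]; _∷_)
open import Data.List.Relation.Unary.Linked using (Linked; linked?)
open import Data.List.Relation.Unary.Unique.Propositional using (Unique)
open import Data.List.Relation.Unary.Unique.Propositional.Properties
  using (filter⁺; cartesianProductWith⁺; allFin⁺)
open import Data.List.Relation.Unary.Unique.DecPropositional using (unique?)
open import Data.Maybe.Base using (just)
open import Data.Maybe.Properties using (≡-dec)
open import Data.Product using (∃-syntax; _×_; _,_; proj₁; proj₂)
open import Data.Sum using (inj₁; inj₂)
open import Relation.Binary using (Rel; Decidable; Symmetric)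
open import Relation.Binary.PropositionalEquality
  using (_≡_; refl; sym; trans; cong; cong₂; subst; subst₂)
open import Relation.Nullary using (Dec; ¬_)
open import Relation.Nullary.Decidable using (_×-dec_; ¬?)

IsCauchy : (ℕ → ℚ) → Set
IsCauchy x = ∀ ε → 0ℚ < ε →
  ∃[ N ] ∀ m n → N ℕ.≤ m → N ℕ.≤ n → ∣ x m - x n ∣ < ε

record ℝ : Set where
  constructor mkℝ
  field
    seq    : ℕ → ℚ
    cauchy : IsCauchy seq

open ℝ public

infix 4 _≤ᴿ_ _≥ᴿ_

_≤ᴿ_ : ℝ → ℝ → Set
x ≤ᴿ y = ∀ ε → 0ℚ < ε → ∃[ N ] ∀ n → N ℕ.≤ n → seq x n ≤ seq y n + ε

_≥ᴿ_ : ℝ → ℝ → Set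
x ≥ᴿ y = y ≤ᴿ x

private
  recip : (δ : ℚ) → 0ℚ < δ → ℚ
  recip δ 0<δ = (1/ δ) {{>-nonZero 0<δ}}

  inv-pos : ∀ δ (0<δ : 0ℚ < δ) → 0ℚ < recip δ 0<δ
  inv-pos δ 0<δ = ℚₚ.positive⁻¹ _ {{ℚₚ.1/pos⇒pos δ {{positive 0<δ}}}}

  inv-mulˡ : ∀ δ (0<δ : 0ℚ < δ) → (recip δ 0<δ) * δ ≡ 1ℚ
  inv-mulˡ δ 0<δ = ℚₚ.*-inverseˡ δ {{>-nonZero 0<δ}}

  *-pos : ∀ {p q} → 0ℚ < p → 0ℚ < q → 0ℚ < p * q
  *-pos {p} {q} 0<p 0<q =
    ℚₚ.positive⁻¹ _ {{ℚₚ.pos*pos⇒pos p {{positive 0<p}} q {{positive 0<q}}}}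

  *-mono : ∀ {p q r s} → 0ℚ ≤ p → 0ℚ ≤ s → p ≤ q → r ≤ s → p * r ≤ q * s
  *-mono {p} {q} {r} {s} 0≤p 0≤s p≤q r≤s = ℚₚ.≤-trans
    (ℚₚ.*-monoˡ-≤-nonNeg p {{nonNegative 0≤p}} r≤s)
    (ℚₚ.*-monoʳ-≤-nonNeg s {{nonNegative 0≤s}} p≤q)

  inv-anti : ∀ δ (0<δ : 0ℚ < δ) a (0<a : 0ℚ < a) → δ ≤ a →
             recip a 0<a ≤ recip δ 0<δ
  inv-anti δ 0<δ a 0<a δ≤a = ℚₚ.*-cancelʳ-≤-pos a {{positive 0<a}} (begin
    (recip a 0<a) * a  ≡⟨ trans (inv-mulˡ a 0<a) (sym (inv-mulˡ δ 0<δ)) ⟩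
    (recip δ 0<δ) * δ  ≤⟨ ℚₚ.*-monoˡ-≤-nonNeg (recip δ 0<δ) {{nonNegative (ℚₚ.<⇒≤ (inv-pos δ 0<δ))}} δ≤a ⟩
    (recip δ 0<δ) * a  ∎)
    where open ℚₚ.≤-Reasoning

  1>0 : 0ℚ < 1ℚ
  1>0 = ℚₚ.positive⁻¹ 1ℚ

  ½>0 : 0ℚ < ½
  ½>0 = ℚₚ.positive⁻¹ ½

fromℚ : ℚ → ℝ
fromℚ q = mkℝ (λ _ → q) λ ε 0<ε →
  0 , λ _ _ _ _ → subst (λ z → ∣ z ∣ < ε) (sym (ℚₚ.+-inverseʳ q)) 0<ε

infixl 6 _+ᴿ_ _-ᴿ_
infixl 7 _*ᴿ_
infix  8 -ᴿ_ _⁻¹ᴿ⟨_⟩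

_+ᴿ_ : ℝ → ℝ → ℝ
x +ᴿ y = mkℝ (λ n → seq x n + seq y n) isCauchy
  where
  isCauchy : IsCauchy (λ n → seq x n + seq y n)
  isCauchy ε 0<ε
    with cauchy x (ε * ½) (*-pos 0<ε ½>0) | cauchy y (ε * ½) (*-pos 0<ε ½>0)
  ... | N₁ , h₁ | N₂ , h₂ = N₁ ℕ.⊔ N₂ , λ m n N≤m N≤n → begin-strict
    ∣ (seq x m + seq y m) - (seq x n + seq y n) ∣
      ≡⟨ cong ∣_∣ (solve 4 (λ a b c d → (a :+ b) :- (c :+ d) := (a :- c) :+ (b :- d)) refl
           (seq x m) (seq y m) (seq x n) (seq y n)) ⟩
    ∣ (seq x m - seq x n) + (seq y m - seq y n) ∣
      ≤⟨ ℚₚ.∣p+q∣≤∣p∣+∣q∣ (seq x m - seq x n) (seq y m - seq y n) ⟩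
    ∣ seq x m - seq x n ∣ + ∣ seq y m - seq y n ∣
      <⟨ ℚₚ.+-mono-< (h₁ m n (ℕₚ.m⊔n≤o⇒m≤o N₁ N₂ N≤m) (ℕₚ.m⊔n≤o⇒m≤o N₁ N₂ N≤n))
                     (h₂ m n (ℕₚ.m⊔n≤o⇒n≤o N₁ N₂ N≤m) (ℕₚ.m⊔n≤o⇒n≤o N₁ N₂ N≤n)) ⟩
    ε * ½ + ε * ½
      ≡⟨ trans (sym (ℚₚ.*-distribˡ-+ ε ½ ½)) (ℚₚ.*-identityʳ ε) ⟩
    ε ∎
    where
    open ℚₚ.≤-Reasoning
    open +-*-Solver

-ᴿ_ : ℝ → ℝ
-ᴿ x = mkℝ (λ n → - seq x n) λ ε 0<ε → proj₁ (cauchy x ε 0<ε) , λ m n N≤m N≤n →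
  subst (_< ε)
    (trans (sym (ℚₚ.∣-p∣≡∣p∣ (seq x m - seq x n)))
           (cong ∣_∣ (ℚₚ.neg-distrib-+ (seq x m) (- seq x n))))
    (proj₂ (cauchy x ε 0<ε) m n N≤m N≤n)

_-ᴿ_ : ℝ → ℝ → ℝ
x -ᴿ y = x +ᴿ (-ᴿ y)

private
  bounded : ∀ x → IsCauchy x → ∃[ B ] 0ℚ < B × (∃[ N ] ∀ n → N ℕ.≤ n → ∣ x n ∣ ≤ B)
  bounded x x-cauchy with x-cauchy 1ℚ 1>0
  ... | N , h = 1ℚ + ∣ x N ∣
    , ℚₚ.+-mono-<-≤ 1>0 (ℚₚ.0≤∣p∣ (x N))
    , N , λ n N≤n → begin
      ∣ x n ∣                    ≡⟨ cong ∣_∣ (solve 2 (λ a b → a := (a :- b) :+ b) refl (x n) (x N)) ⟩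
      ∣ (x n - x N) + x N ∣      ≤⟨ ℚₚ.∣p+q∣≤∣p∣+∣q∣ (x n - x N) (x N) ⟩
      ∣ x n - x N ∣ + ∣ x N ∣    ≤⟨ ℚₚ.+-monoˡ-≤ ∣ x N ∣ (ℚₚ.<⇒≤ (h n N N≤n ℕₚ.≤-refl)) ⟩
      1ℚ + ∣ x N ∣               ∎
    where
    open ℚₚ.≤-Reasoning
    open +-*-Solver

private
  *-close : ∀ {A B η xm xn ym yn} → 0ℚ < A → 0ℚ < B → ∣ xm ∣ ≤ A → ∣ yn ∣ ≤ B →
            ∣ xm - xn ∣ < η → ∣ ym - yn ∣ < η → ∣ xm * ym - xn * yn ∣ < η * (A + B)
  *-close {A} {B} {η} {xm} {xn} {ym} {yn} 0<A 0<B x≤A y≤B dx dy = begin-strict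
    ∣ xm * ym - xn * yn ∣
      ≡⟨ cong ∣_∣ (solve 4 (λ a b c d → a :* b :- c :* d := a :* (b :- d) :+ (a :- c) :* d) refl
           xm ym xn yn) ⟩
    ∣ xm * (ym - yn) + (xm - xn) * yn ∣
      ≤⟨ ℚₚ.∣p+q∣≤∣p∣+∣q∣ (xm * (ym - yn)) ((xm - xn) * yn) ⟩
    ∣ xm * (ym - yn) ∣ + ∣ (xm - xn) * yn ∣
      ≡⟨ cong₂ _+_ (ℚₚ.∣p*q∣≡∣p∣*∣q∣ xm (ym - yn)) (ℚₚ.∣p*q∣≡∣p∣*∣q∣ (xm - xn) yn) ⟩
    ∣ xm ∣ * ∣ ym - yn ∣ + ∣ xm - xn ∣ * ∣ yn ∣
      ≤⟨ ℚₚ.+-mono-≤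
           (ℚₚ.*-monoʳ-≤-nonNeg ∣ ym - yn ∣ {{ℚₚ.∣-∣-nonNeg (ym - yn)}} x≤A)
           (ℚₚ.*-monoˡ-≤-nonNeg ∣ xm - xn ∣ {{ℚₚ.∣-∣-nonNeg (xm - xn)}} y≤B) ⟩
    A * ∣ ym - yn ∣ + ∣ xm - xn ∣ * B
      <⟨ ℚₚ.+-mono-< (ℚₚ.*-monoʳ-<-pos A {{positive 0<A}} dy)
                     (ℚₚ.*-monoˡ-<-pos B {{positive 0<B}} dx) ⟩
    A * η + η * B
      ≡⟨ solve 3 (λ a b c → a :* c :+ c :* b := c :* (a :+ b)) refl A B η ⟩
    η * (A + B) ∎
    where
    open ℚₚ.≤-Reasoning
    open +-*-Solver

  *-isCauchy : ∀ x y → IsCauchy x → IsCauchy y → IsCauchy (λ n → x n * y n)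
  *-isCauchy x y x-cauchy y-cauchy ε 0<ε =
    let (A , 0<A , N₁ , x≤A) = bounded x x-cauchy
        (B , 0<B , N₂ , y≤B) = bounded y y-cauchy
        0<A+B = ℚₚ.+-mono-< 0<A 0<B
        η     = ε * recip (A + B) 0<A+B
        0<η   = *-pos 0<ε (inv-pos (A + B) 0<A+B)
        (N₃ , dx) = x-cauchy η 0<η
        (N₄ , dy) = y-cauchy η 0<η
    in (N₁ ℕ.⊔ N₂) ℕ.⊔ (N₃ ℕ.⊔ N₄) , λ m n N≤m N≤n →
      let N₁₂≤m = ℕₚ.m⊔n≤o⇒m≤o (N₁ ℕ.⊔ N₂) (N₃ ℕ.⊔ N₄) N≤m
          N₁₂≤n = ℕₚ.m⊔n≤o⇒m≤o (N₁ ℕ.⊔ N₂) (N₃ ℕ.⊔ N₄) N≤n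
          N₃₄≤m = ℕₚ.m⊔n≤o⇒n≤o (N₁ ℕ.⊔ N₂) (N₃ ℕ.⊔ N₄) N≤m
          N₃₄≤n = ℕₚ.m⊔n≤o⇒n≤o (N₁ ℕ.⊔ N₂) (N₃ ℕ.⊔ N₄) N≤n
      in subst (∣ x m * y m - x n * y n ∣ <_)
           (trans (ℚₚ.*-assoc ε (recip (A + B) 0<A+B) (A + B))
             (trans (cong (ε *_) (inv-mulˡ (A + B) 0<A+B)) (ℚₚ.*-identityʳ ε)))
           (*-close 0<A 0<B
             (x≤A m (ℕₚ.m⊔n≤o⇒m≤o N₁ N₂ N₁₂≤m)) (y≤B n (ℕₚ.m⊔n≤o⇒n≤o N₁ N₂ N₁₂≤n))
             (dx m n (ℕₚ.m⊔n≤o⇒m≤o N₃ N₄ N₃₄≤m) (ℕₚ.m⊔n≤o⇒m≤o N₃ N₄ N₃₄≤n))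
             (dy m n (ℕₚ.m⊔n≤o⇒n≤o N₃ N₄ N₃₄≤m) (ℕₚ.m⊔n≤o⇒n≤o N₃ N₄ N₃₄≤n)))

_*ᴿ_ : ℝ → ℝ → ℝ
x *ᴿ y = mkℝ (λ n → seq x n * seq y n) (*-isCauchy (seq x) (seq y) (cauchy x) (cauchy y))

private
  recip-close : ∀ δ (0<δ : 0ℚ < δ) a (0<a : 0ℚ < a) b (0<b : 0ℚ < b) {η} →
                δ ≤ a → δ ≤ b → ∣ b - a ∣ < η * (δ * δ) →
                ∣ recip a 0<a - recip b 0<b ∣ < η
  recip-close δ 0<δ a 0<a b 0<b {η} δ≤a δ≤b close = begin-strict
    ∣ a′ - b′ ∣
      ≡⟨ cong ∣_∣ (cong₂ _-_
           (sym (trans (cong (a′ *_) (inv-mulˡ b 0<b)) (ℚₚ.*-identityʳ a′)))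
           (sym (trans (cong (b′ *_) (inv-mulˡ a 0<a)) (ℚₚ.*-identityʳ b′)))) ⟩
    ∣ a′ * (b′ * b) - b′ * (a′ * a) ∣
      ≡⟨ cong ∣_∣ (solve 4 (λ p q r s → r :* (s :* q) :- s :* (r :* p) := (q :- p) :* (r :* s)) refl
           a b a′ b′) ⟩
    ∣ (b - a) * (a′ * b′) ∣
      ≡⟨ trans (ℚₚ.∣p*q∣≡∣p∣*∣q∣ (b - a) (a′ * b′)) (cong (∣ b - a ∣ *_) (ℚₚ.0≤p⇒∣p∣≡p 0≤a′b′)) ⟩
    ∣ b - a ∣ * (a′ * b′)
      ≤⟨ ℚₚ.*-monoˡ-≤-nonNeg ∣ b - a ∣ {{ℚₚ.∣-∣-nonNeg (b - a)}}
           (*-mono (ℚₚ.<⇒≤ 0<a′) (ℚₚ.<⇒≤ (inv-pos δ 0<δ))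
             (inv-anti δ 0<δ a 0<a δ≤a) (inv-anti δ 0<δ b 0<b δ≤b)) ⟩
    ∣ b - a ∣ * (i * i)
      <⟨ ℚₚ.*-monoˡ-<-pos (i * i) {{positive (*-pos (inv-pos δ 0<δ) (inv-pos δ 0<δ))}} close ⟩
    η * (δ * δ) * (i * i)
      ≡⟨ solve 3 (λ c d j → c :* (d :* d) :* (j :* j) := c :* ((j :* d) :* (j :* d))) refl η δ i ⟩
    η * ((i * δ) * (i * δ))
      ≡⟨ cong (η *_) (cong₂ _*_ (inv-mulˡ δ 0<δ) (inv-mulˡ δ 0<δ)) ⟩
    η * 1ℚ
      ≡⟨ ℚₚ.*-identityʳ η ⟩
    η ∎
    where
    open ℚₚ.≤-Reasoning
    open +-*-Solver
    a′ = recip a 0<a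
    b′ = recip b 0<b
    i  = recip δ 0<δ
    0<a′ = inv-pos a 0<a
    0≤a′b′ = ℚₚ.<⇒≤ (*-pos 0<a′ (inv-pos b 0<b))

Positiveᴿ : ℝ → Set
Positiveᴿ x = ∃[ δ ] 0ℚ < δ × (∃[ N ] ∀ n → N ℕ.≤ n → δ ≤ seq x n)

-- The reciprocal uses only the tail of the sequence known to be bounded
-- away from zero, so no value has to be assigned to 1/0.
_⁻¹ᴿ⟨_⟩ : (x : ℝ) → Positiveᴿ x → ℝ
x ⁻¹ᴿ⟨ δ , 0<δ , N , δ≤x ⟩ = mkℝ inv isCauchy
  where
  0<x : ∀ n → 0ℚ < seq x (N ℕ.+ n)
  0<x n = ℚₚ.<-≤-trans 0<δ (δ≤x (N ℕ.+ n) (ℕₚ.m≤m+n N n))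

  inv : ℕ → ℚ
  inv n = (1/ seq x (N ℕ.+ n)) {{>-nonZero (0<x n)}}

  isCauchy : IsCauchy inv
  isCauchy ε 0<ε =
    let (K , h) = cauchy x (ε * (δ * δ)) (*-pos 0<ε (*-pos 0<δ 0<δ))
    in K , λ m n K≤m K≤n → recip-close δ 0<δ _ (0<x m) _ (0<x n)
         (δ≤x _ (ℕₚ.m≤m+n N m)) (δ≤x _ (ℕₚ.m≤m+n N n))
         (h (N ℕ.+ n) (N ℕ.+ m)
           (ℕₚ.≤-trans K≤n (ℕₚ.m≤n+m n N)) (ℕₚ.≤-trans K≤m (ℕₚ.m≤n+m m N)))

1/[_!] : ℕ → ℚ
1/[ i !] = (+ 1 / (i !)) {{i ℕₚ.!≢0}}

Σ1/i! : ℕ → ℚ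
Σ1/i! zero    = 1/[ 0 !]
Σ1/i! (suc n) = Σ1/i! n + 1/[ suc n !]

private
  toℚᵘ-1/ : ∀ n .{{_ : ℕ.NonZero n}} → toℚᵘ (+ 1 / n) ℚᵘ.≃ (+ 1 ℚᵘ./ n)
  toℚᵘ-1/ (suc n) = ℚₚ.toℚᵘ-fromℚᵘ (ℚᵘ.mkℚᵘ (+ 1) n)

  1/-pos : ∀ n .{{_ : ℕ.NonZero n}} → 0ℚ < + 1 / n
  1/-pos n = ℚₚ.positive⁻¹ _ {{ℚₚ.normalize-pos 1 n}}

  n≤n! : ∀ n → n ℕ.≤ n !
  n≤n! zero    = z≤n
  n≤n! (suc n) = ℕₚ.m≤m*n (suc n) (n !) {{n ℕₚ.!≢0}}

  1/-frac : ∀ a b c .{{_ : ℕ.NonZero a}} .{{_ : ℕ.NonZero b}} .{{_ : ℕ.NonZero c}} →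
            (b ℕ.+ a) ℕ.* c ℕ.≤ a ℕ.* b → + 1 / a + + 1 / b ≤ + 1 / c
  1/-frac a@(suc _) b@(suc _) c@(suc _) h = ℚₚ.toℚᵘ-cancel-≤ (begin
    toℚᵘ (+ 1 / a + + 1 / b)               ≃⟨ ℚₚ.toℚᵘ-homo-+ (+ 1 / a) (+ 1 / b) ⟩
    toℚᵘ (+ 1 / a) ℚᵘ.+ toℚᵘ (+ 1 / b)     ≃⟨ ℚᵘₚ.+-cong (toℚᵘ-1/ a) (toℚᵘ-1/ b) ⟩
    (+ 1 ℚᵘ./ a) ℚᵘ.+ (+ 1 ℚᵘ./ b)         ≤⟨ ℚᵘ.*≤* (subst₂ ℤ._≤_ lhs rhs (+≤+ h)) ⟩
    + 1 ℚᵘ./ c                             ≃⟨ ℚᵘₚ.≃-sym (toℚᵘ-1/ c) ⟩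
    toℚᵘ (+ 1 / c)                         ∎)
    where
    open ℚᵘₚ.≤-Reasoning
    lhs : + ((b ℕ.+ a) ℕ.* c) ≡ (+ 1 ℤ.* + b ℤ.+ + 1 ℤ.* + a) ℤ.* + c
    lhs = trans (ℤₚ.pos-* (b ℕ.+ a) c)
      (cong (ℤ._* + c) (cong₂ ℤ._+_ (sym (ℤₚ.*-identityˡ (+ b))) (sym (ℤₚ.*-identityˡ (+ a)))))
    rhs : + (a ℕ.* b) ≡ + 1 ℤ.* (+ a ℤ.* + b)
    rhs = trans (ℤₚ.pos-* a b) (sym (ℤₚ.*-identityˡ (+ a ℤ.* + b)))

  tail-step : ∀ j → Σ1/i! (suc (suc j)) + + 1 / suc (suc j) ≤ Σ1/i! (suc j) + + 1 / suc j
  tail-step j = subst (_≤ Σ1/i! m + + 1 / m)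
    (sym (ℚₚ.+-assoc (Σ1/i! m) 1/[ suc m !] (+ 1 / suc m)))
    (ℚₚ.+-monoʳ-≤ (Σ1/i! m) (1/-frac (suc m !) (suc m) m {{suc m ℕₚ.!≢0}} (begin
      (suc m ℕ.+ suc m !) ℕ.* m              ≡⟨ ℕₚ.*-distribʳ-+ m (suc m) (suc m !) ⟩
      suc m ℕ.* m ℕ.+ suc m ! ℕ.* m          ≤⟨ ℕₚ.+-monoˡ-≤ _ (ℕₚ.*-monoʳ-≤ (suc m) (n≤n! m)) ⟩
      suc m ! ℕ.+ suc m ! ℕ.* m              ≡⟨ ℕₚ.*-suc (suc m !) m ⟨
      suc m ! ℕ.* suc m                      ∎)))
    where
    open ℕₚ.≤-Reasoning
    m = suc j

  ≤-+-nonNeg : ∀ {p q} → 0ℚ ≤ q → p ≤ p + q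
  ≤-+-nonNeg {p} {q} 0≤q = subst (_≤ p + q) (ℚₚ.+-identityʳ p) (ℚₚ.+-monoʳ-≤ p 0≤q)

  Σ-mono : ∀ n k → Σ1/i! n ≤ Σ1/i! (k ℕ.+ n)
  Σ-mono n zero    = ℚₚ.≤-refl
  Σ-mono n (suc k) = ℚₚ.≤-trans (Σ-mono n k)
    (≤-+-nonNeg (ℚₚ.<⇒≤ (1/-pos (suc (k ℕ.+ n) !) {{suc (k ℕ.+ n) ℕₚ.!≢0}})))

  Σ-tail : ∀ j k → Σ1/i! (k ℕ.+ suc j) + + 1 / suc (k ℕ.+ j) ≤ Σ1/i! (suc j) + + 1 / suc j
  Σ-tail j zero    = ℚₚ.≤-refl
  Σ-tail j (suc k) = ℚₚ.≤-trans
    (subst (λ z → Σ1/i! (suc z) + + 1 / suc (suc (k ℕ.+ j)) ≤ Σ1/i! (k ℕ.+ suc j) + + 1 / suc (k ℕ.+ j))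
      (sym (ℕₚ.+-suc k j))
      (subst (λ z → Σ1/i! (suc (suc (k ℕ.+ j))) + + 1 / suc (suc (k ℕ.+ j)) ≤ Σ1/i! z + + 1 / suc (k ℕ.+ j))
        (sym (ℕₚ.+-suc k j)) (tail-step (k ℕ.+ j))))
    (Σ-tail j k)

  Σ-bounds : ∀ j m → suc j ℕ.≤ m →
             Σ1/i! (suc j) ≤ Σ1/i! m × Σ1/i! m ≤ Σ1/i! (suc j) + + 1 / suc j
  Σ-bounds j m j<m = subst
    (λ z → Σ1/i! (suc j) ≤ Σ1/i! z × Σ1/i! z ≤ Σ1/i! (suc j) + + 1 / suc j)
    (ℕₚ.m∸n+n≡m j<m)
    (Σ-mono (suc j) k , ℚₚ.≤-trans (≤-+-nonNeg (ℚₚ.<⇒≤ (1/-pos (suc (k ℕ.+ j))))) (Σ-tail j k))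
    where k = m ℕ.∸ suc j

  ∣-∣-within : ∀ {a r p q} → a ≤ p → p ≤ a + r → a ≤ q → q ≤ a + r → ∣ p - q ∣ ≤ r
  ∣-∣-within {a} {r} {p} {q} a≤p p≤ a≤q q≤ with ℚₚ.∣p∣≡p∨∣p∣≡-p (p - q)
  ... | inj₁ eq = subst₂ _≤_ (sym eq)
    (solve 2 (λ x y → (x :+ y) :- x := y) refl a r)
    (ℚₚ.+-mono-≤ p≤ (ℚₚ.neg-antimono-≤ a≤q))
    where open +-*-Solver
  ... | inj₂ eq = subst₂ _≤_
    (trans (solve 2 (λ x y → y :- x := :- (x :- y)) refl p q) (sym eq))
    (solve 2 (λ x y → (x :+ y) :- x := y) refl a r)
    (ℚₚ.+-mono-≤ q≤ (ℚₚ.neg-antimono-≤ a≤p))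
    where open +-*-Solver

  archimedean : ∀ ε → 0ℚ < ε → ∃[ j ] + 1 / suc j < ε
  archimedean ε@(mkℚ (+ suc p) d _) _ = suc d , ℚₚ.toℚᵘ-cancel-< (begin-strict
    toℚᵘ (+ 1 / suc (suc d))   ≃⟨ toℚᵘ-1/ (suc (suc d)) ⟩
    + 1 ℚᵘ./ suc (suc d)       <⟨ ℚᵘ.*<* (subst₂ ℤ._<_ (ℤₚ.pos-* 1 (suc d)) (ℤₚ.pos-* (suc p) (suc (suc d))) (+<+ lt)) ⟩
    toℚᵘ ε                     ∎)
    where
    open ℚᵘₚ.≤-Reasoning
    lt : 1 ℕ.* suc d ℕ.< suc p ℕ.* suc (suc d)
    lt = ℕₚ.≤-trans
      (s≤s (ℕₚ.≤-reflexive (ℕₚ.*-identityˡ (suc d))))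
      (ℕₚ.m≤n*m (suc (suc d)) (suc p))
  archimedean (mkℚ (+ zero) d c) 0<ε with positive 0<ε
  ... | ()
  archimedean (mkℚ ℤ.-[1+ p ] d c) 0<ε with positive 0<ε
  ... | ()

e : ℝ
e = mkℝ Σ1/i! isCauchy
  where
  isCauchy : IsCauchy Σ1/i!
  isCauchy ε 0<ε with archimedean ε 0<ε
  ... | j , 1/j<ε = suc j , λ m n j<m j<n →
    let (l₁ , u₁) = Σ-bounds j m j<m ; (l₂ , u₂) = Σ-bounds j n j<n
    in ℚₚ.≤-<-trans (∣-∣-within l₁ u₁ l₂ u₂) 1/j<ε

e-positive : Positiveᴿ e
e-positive = 1ℚ , 1>0 , 0 , λ n _ →
  subst (λ z → 1ℚ ≤ Σ1/i! z) (ℕₚ.+-identityʳ n) (Σ-mono 0 n)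

1-1/e : ℝ
1-1/e = fromℚ 1ℚ -ᴿ e ⁻¹ᴿ⟨ e-positive ⟩

-- Loops are not excluded; no shortest path uses one.
record Graph (n : ℕ) : Set₁ where
  field
    _~_   : Rel (Fin n) 0ℓ
    _~?_  : Decidable _~_
    ~-sym : Symmetric _~_

module _ {n : ℕ} (G : Graph n) where
  open Graph G

  IsPath : Fin n → Fin n → List (Fin n) → Set
  IsPath s t p = head p ≡ just s × last p ≡ just t × Linked _~_ p × Unique p

  IsShortestPath : Fin n → Fin n → List (Fin n) → Set
  IsShortestPath s t p =
    IsPath s t p × (∀ q → IsPath s t q → length p ℕ.≤ length q)

  isPath? : ∀ s t p → Dec (IsPath s t p)
  isPath? s t p =
    ≡-dec Finₚ._≟_ (head p) (just s) ×-dec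
    ≡-dec Finₚ._≟_ (last p) (just t) ×-dec
    linked? _~?_ p ×-dec
    unique? Finₚ._≟_ p

  vertexLists : ℕ → List (List (Fin n))
  vertexLists zero    = [] ∷ []
  vertexLists (suc ℓ) = [] ∷ cartesianProductWith _∷_ (allFin n) (vertexLists ℓ)

  -- A path has no repeated vertex, hence at most n vertices.
  paths : Fin n → Fin n → List (List (Fin n))
  paths s t = filter (isPath? s t) (vertexLists n)

  shortestPaths : Fin n → Fin n → List (List (Fin n))
  shortestPaths s t =
    filter (λ p → all? (λ q → length p ℕ.≤? length q) (paths s t)) (paths s t)

  private
    ∈-vertexLists : ∀ ℓ p → length p ℕ.≤ ℓ → p ∈ vertexLists ℓ
    ∈-vertexLists zero    []      _       = here refl
    ∈-vertexLists (suc ℓ) []      _       = here refl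
    ∈-vertexLists (suc ℓ) (v ∷ p) (s≤s h) =
      there (∈-cartesianProductWith⁺ _∷_ (∈-allFin v) (∈-vertexLists ℓ p h))

    vertexLists-unique : ∀ ℓ → Unique (vertexLists ℓ)
    vertexLists-unique zero    = All.[] ∷ []
    vertexLists-unique (suc ℓ) =
      ¬Any⇒All¬ _ []∉ ∷ cartesianProductWith⁺ _∷_ ∷-injective (allFin⁺ n) (vertexLists-unique ℓ)
      where
      []∉ : ¬ ([] ∈ cartesianProductWith _∷_ (allFin n) (vertexLists ℓ))
      []∉ h with ∈-cartesianProductWith⁻ _∷_ (allFin n) (vertexLists ℓ) h
      ... | _ , _ , _ , _ , ()

    lookup-injective : ∀ {p : List (Fin n)} → Unique p →
                       ∀ {i j} → lookup p i ≡ lookup p j → i ≡ j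
    lookup-injective (_ ∷ _) {zero}  {zero}  _  = refl
    lookup-injective (v∉ ∷ _) {zero}  {suc j} eq = ⊥-elim (All.lookup v∉ (∈-lookup j) eq)
    lookup-injective (v∉ ∷ _) {suc i} {zero}  eq = ⊥-elim (All.lookup v∉ (∈-lookup i) (sym eq))
    lookup-injective (_ ∷ uniq) {suc i} {suc j} eq = cong suc (lookup-injective uniq eq)

    ∈-paths : ∀ {s t p} → IsPath s t p → p ∈ paths s t
    ∈-paths {s} {t} {p} isPath@(_ , _ , _ , uniq) = ∈-filter⁺ (isPath? s t)
      (∈-vertexLists n p (Finₚ.injective⇒≤ (lookup-injective uniq))) isPath

  ∈-shortestPaths⁺ : ∀ {s t p} → IsShortestPath s t p → p ∈ shortestPaths s t
  ∈-shortestPaths⁺ {s} {t} (isPath , minimal) =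
    ∈-filter⁺ (λ p → all? (λ q → length p ℕ.≤? length q) (paths s t)) (∈-paths isPath)
      (All.tabulate λ {q} q∈ → minimal q (proj₂ (∈-filter⁻ (isPath? s t) {xs = vertexLists n} q∈)))

  ∈-shortestPaths⁻ : ∀ {s t p} → p ∈ shortestPaths s t → IsShortestPath s t p
  ∈-shortestPaths⁻ {s} {t} p∈ with
    ∈-filter⁻ (λ p → all? (λ q → length p ℕ.≤? length q) (paths s t)) {xs = paths s t} p∈
  ... | p∈paths , minimal =
    proj₂ (∈-filter⁻ (isPath? s t) {xs = vertexLists n} p∈paths) ,
    λ q isPath → All.lookup minimal (∈-paths isPath)

  shortestPaths-unique : ∀ s t → Unique (shortestPaths s t)
  shortestPaths-unique s t = filter⁺ _ (filter⁺ (isPath? s t) (vertexLists-unique n))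

  σ : Fin n → Fin n → ℕ
  σ s t = length (shortestPaths s t)

  Traverses : Subset n → List (Fin n) → Set
  Traverses S p = Any (_∈ₛ S) p

  traverses? : ∀ S p → Dec (Traverses S p)
  traverses? S = any? (_∈? S)

  σ̈ : Fin n → Fin n → Subset n → ℕ
  σ̈ s t S = length (filter (traverses? S) (shortestPaths s t))

  fraction : ℕ → ℕ → ℚ
  fraction a zero      = 0ℚ
  fraction a b@(suc _) = + a / b

  distinctPairs : List (Fin n × Fin n)
  distinctPairs = filter (λ (s , t) → ¬? (s Finₚ.≟ t)) (cartesianProduct (allFin n) (allFin n))

  sumℚ : List ℚ → ℚ
  sumℚ = foldr _+_ 0ℚ

  GBC : Subset n → ℚ
  GBC S = sumℚ (map (λ (s , t) → fraction (σ̈ s t S) (σ s t)) distinctPairs)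

  GBC^ : Subset n → Subset n → ℚ
  GBC^ A X = GBC (A ∪ X) - GBC A

  BC^ : Subset n → Fin n → ℚ
  BC^ A v = GBC^ A ⁅ v ⁆

  -- A relation rather than a function, so that every tie-breaking is covered.
  -- The chosen v may already lie in M; this can happen only when no candidate
  -- has a positive BC^ M.
  data SecondPhase (C : Subset n) : ℕ → Subset n → Subset n → Set where
    stop : ∀ {M} → SecondPhase C 0 M M
    step : ∀ {k M M′} v → v ∈ₛ C → (∀ u → u ∈ₛ C → BC^ M u ≤ BC^ M v) →
           SecondPhase C k (M ∪ ⁅ v ⁆) M′ → SecondPhase C (suc k) M M′

  -- The first phase ends with M = D.
  Returns : (D C : Subset n) → ℕ → Subset n → Set
  Returns D C k R = ∃[ M ] SecondPhase C k D M × R ≡ M ─ D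

  IsMaxContribution : (D C : Subset n) → ℕ → ℚ → Set
  IsMaxContribution D C k m =
    (∃[ M′ ] M′ ⊆ C × card M′ ≡ k × GBC^ D M′ ≡ m) ×
    (∀ M′ → M′ ⊆ C → card M′ ≡ k → GBC^ D M′ ≤ m)

{-# OPTIONS --safe #-}
-- GBC is monotone and submodular, so adding all k nodes of an optimal X to the
-- current M gains at most k times the best single gain; hence each greedy step
-- shrinks the gap GBC (D ∪ X) - GBC M by a factor 1 - 1/k, and k steps by
-- (1 - 1/k)^k.  With Eₙ the n-th Taylor polynomial of exp,
-- (1 - x) Eₙ(y + x) ≤ Eₙ(y) for x, y ≥ 0, so (1 - 1/k)^k Eₙ(1) ≤ 1 for all n:
-- the inequality holds at every index of the sequence defining 1 - 1/e.
module Submission where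

open import Defs
open import Data.Nat using (ℕ; _≤_)
open import Data.Fin.Subset using (Subset; _∩_; Empty; ∣_∣)
open import Data.Product using (∃-syntax; _×_)

open import Data.Empty using (⊥-elim)
open import Data.Fin using (Fin; zero; suc)
open import Data.Fin.Subset using (_∈_; _⊆_; _∪_; _─_; ⁅_⁆; ⊥; inside; outside)
open import Data.Fin.Subset.Properties
  using (⊆-antisym; p⊆p∪q; q⊆p∪q; x∈p∪q⁻; x∈⁅x⁆; x∈p∧x∉q⇒x∈p─q; p─q⊆p;
         _∈?_; _⊆?_; ⊥⊆; ∣⊥∣≡0; s⊆s; out⊆)
import Data.Integer as ℤ
import Data.Integer.Properties as ℤₚ
open import Data.Integer using (+_; +≤+)
open import Data.List.Base using (List; []; _∷_; length; filter; foldr; map)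
import Data.List.Membership.Propositional as List
open import Data.List.Membership.Propositional.Properties using (∈-map⁺; ∈-map⁻)
open import Data.List.Properties using (length-map)
open import Data.List.Relation.Unary.Any as Any using (here; there)
import Data.Nat as ℕ
import Data.Nat.Properties as ℕₚ
open import Data.Product using (_,_; proj₁; proj₂)
open import Data.Rational as ℚ
  using (ℚ; 0ℚ; 1ℚ; _+_; _*_; _-_; -_; _/_; 1/_; toℚᵘ; nonNegative; >-nonZero)
import Data.Rational.Properties as ℚₚ
open import Data.Rational.Solver using (module +-*-Solver)
import Data.Rational.Unnormalised as ℚᵘ
import Data.Rational.Unnormalised.Properties as ℚᵘₚ
open import Data.Sum using (_⊎_; inj₁; inj₂; [_,_]′)
import Data.Vec.Base as Vec
open import Data.Vec.Base using ([]; _∷_)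
open import Relation.Binary.PropositionalEquality
  using (_≡_; refl; sym; trans; cong; cong₂; subst; subst₂; module ≡-Reasoning)
open import Level using (0ℓ)
open import Relation.Nullary using (¬_; Dec; yes; no)
open import Relation.Nullary.Decidable using (_×-dec_)
open import Relation.Unary using (Pred; Decidable)
open import Algebra.Definitions.RawSemiring ℚₚ.+-*-rawSemiring using (_^_)

open +-*-Solver using (solve; _:+_; _:*_; _:-_; _:=_; con)

-- Rational arithmetic

ι : ℕ → ℚ
ι n = + n / 1

-- `_/_` normalises by a gcd, which does not compute on variables. Over the unnormalised rationals,
-- the next facts about fractions reduce to cross-multiplication in the integers.
toℚᵘ-/ : ∀ a b .{{_ : ℕ.NonZero b}} → toℚᵘ (+ a / b) ℚᵘ.≃ (+ a ℚᵘ./ b)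
toℚᵘ-/ a (ℕ.suc b) = ℚₚ.toℚᵘ-fromℚᵘ (ℚᵘ.mkℚᵘ (+ a) b)

/-mono-≤ : ∀ {a b} c .{{_ : ℕ.NonZero c}} → a ≤ b → + a / c ℚ.≤ + b / c
/-mono-≤ {a} {b} c@(ℕ.suc _) a≤b = ℚₚ.toℚᵘ-cancel-≤ (begin
  toℚᵘ (+ a / c)  ≃⟨ toℚᵘ-/ a c ⟩
  + a ℚᵘ./ c      ≤⟨ ℚᵘ.*≤* (ℤₚ.*-monoʳ-≤-nonNeg (+ c) (+≤+ a≤b)) ⟩
  + b ℚᵘ./ c      ≃⟨ toℚᵘ-/ b c ⟨
  toℚᵘ (+ b / c)  ∎)
  where open ℚᵘₚ.≤-Reasoning

+-/ : ∀ a b c .{{_ : ℕ.NonZero c}} → + a / c + + b / c ≡ + (a ℕ.+ b) / c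
+-/ a b c@(ℕ.suc _) = ℚₚ.toℚᵘ-injective (begin-equality
  toℚᵘ (+ a / c + + b / c)            ≃⟨ ℚₚ.toℚᵘ-homo-+ (+ a / c) (+ b / c) ⟩
  toℚᵘ (+ a / c) ℚᵘ.+ toℚᵘ (+ b / c)  ≃⟨ ℚᵘₚ.+-cong (toℚᵘ-/ a c) (toℚᵘ-/ b c) ⟩
  (+ a ℚᵘ./ c) ℚᵘ.+ (+ b ℚᵘ./ c)      ≃⟨ ℚᵘ.*≡* cross ⟩
  + (a ℕ.+ b) ℚᵘ./ c                  ≃⟨ toℚᵘ-/ (a ℕ.+ b) c ⟨
  toℚᵘ (+ (a ℕ.+ b) / c)              ∎)
  where
  open ℚᵘₚ.≤-Reasoning
  cross : (+ a ℤ.* + c ℤ.+ + b ℤ.* + c) ℤ.* + c ≡ + (a ℕ.+ b) ℤ.* (+ c ℤ.* + c)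
  cross = trans (cong (ℤ._* + c) (sym (ℤₚ.*-distribʳ-+ (+ c) (+ a) (+ b))))
                (ℤₚ.*-assoc (+ (a ℕ.+ b)) (+ c) (+ c))

*-/ : ∀ a b c d .{{_ : ℕ.NonZero b}} .{{_ : ℕ.NonZero d}} →
      (+ a / b) * (+ c / d) ≡ (+ (a ℕ.* c) / (b ℕ.* d)) {{ℕₚ.m*n≢0 b d}}
*-/ a b@(ℕ.suc _) c d@(ℕ.suc _) = ℚₚ.toℚᵘ-injective (begin-equality
  toℚᵘ ((+ a / b) * (+ c / d))        ≃⟨ ℚₚ.toℚᵘ-homo-* (+ a / b) (+ c / d) ⟩
  toℚᵘ (+ a / b) ℚᵘ.* toℚᵘ (+ c / d)  ≃⟨ ℚᵘₚ.*-cong (toℚᵘ-/ a b) (toℚᵘ-/ c d) ⟩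
  (+ a ℚᵘ./ b) ℚᵘ.* (+ c ℚᵘ./ d)      ≃⟨ ℚᵘ.*≡* (cong (ℤ._* + (b ℕ.* d)) (sym (ℤₚ.pos-* a c))) ⟩
  + (a ℕ.* c) ℚᵘ./ (b ℕ.* d)          ≃⟨ toℚᵘ-/ (a ℕ.* c) (b ℕ.* d) ⟨
  toℚᵘ (+ (a ℕ.* c) / (b ℕ.* d))      ∎)
  where open ℚᵘₚ.≤-Reasoning

n/n≡1 : ∀ n .{{_ : ℕ.NonZero n}} → + n / n ≡ 1ℚ
n/n≡1 n@(ℕ.suc _) = ℚₚ.toℚᵘ-injective (begin-equality
  toℚᵘ (+ n / n)  ≃⟨ toℚᵘ-/ n n ⟩
  + n ℚᵘ./ n      ≃⟨ ℚᵘ.*≡* (ℤₚ.*-comm (+ n) (+ 1)) ⟩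
  toℚᵘ 1ℚ         ∎)
  where open ℚᵘₚ.≤-Reasoning

ι-suc : ∀ n → ι (ℕ.suc n) ≡ 1ℚ + ι n
ι-suc n = sym (+-/ 1 n 1)

ι*1/n≡1 : ∀ n .{{_ : ℕ.NonZero n}} → ι n * (+ 1 / n) ≡ 1ℚ
ι*1/n≡1 n@(ℕ.suc _) = trans (*-/ n 1 1 n)
  (trans (cong₂ (λ a b → + a / ℕ.suc b) (ℕₚ.*-identityʳ n) (ℕₚ.+-identityʳ (ℕ.pred n))) (n/n≡1 n))

0≤1/n : ∀ n .{{_ : ℕ.NonZero n}} → 0ℚ ℚ.≤ + 1 / n
0≤1/n n = ℚₚ.nonNegative⁻¹ _ {{ℚₚ.normalize-nonNeg 1 n}}

0≤ι : ∀ n → 0ℚ ℚ.≤ ι n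
0≤ι n = ℚₚ.nonNegative⁻¹ _ {{ℚₚ.normalize-nonNeg n 1}}

1/n≤1 : ∀ n .{{_ : ℕ.NonZero n}} → + 1 / n ℚ.≤ 1ℚ
1/n≤1 n = subst (+ 1 / n ℚ.≤_) (n/n≡1 n) (/-mono-≤ n (ℕ.>-nonZero⁻¹ n))

0≤* : ∀ {p q} → 0ℚ ℚ.≤ p → 0ℚ ℚ.≤ q → 0ℚ ℚ.≤ p * q
0≤* {p} {q} 0≤p 0≤q =
  ℚₚ.nonNegative⁻¹ _ {{ℚₚ.nonNeg*nonNeg⇒nonNeg p {{nonNegative 0≤p}} q {{nonNegative 0≤q}}}}

0≤+ : ∀ {p q} → 0ℚ ℚ.≤ p → 0ℚ ℚ.≤ q → 0ℚ ℚ.≤ p + q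
0≤+ = ℚₚ.+-mono-≤

*-monoˡ : ∀ {r p q} → 0ℚ ℚ.≤ r → p ℚ.≤ q → r * p ℚ.≤ r * q
*-monoˡ {r} 0≤r = ℚₚ.*-monoˡ-≤-nonNeg r {{nonNegative 0≤r}}

*-monoʳ : ∀ {r p q} → 0ℚ ℚ.≤ r → p ℚ.≤ q → p * r ℚ.≤ q * r
*-monoʳ {r} 0≤r = ℚₚ.*-monoʳ-≤-nonNeg r {{nonNegative 0≤r}}

0≤^ : ∀ {p} n → 0ℚ ℚ.≤ p → 0ℚ ℚ.≤ p ^ n
0≤^ ℕ.zero    0≤p = 0≤ι 1
0≤^ (ℕ.suc n) 0≤p = 0≤* 0≤p (0≤^ n 0≤p)

p≤q⇒0≤q-p : ∀ {p q} → p ℚ.≤ q → 0ℚ ℚ.≤ q - p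
p≤q⇒0≤q-p {p} {q} p≤q = subst (ℚ._≤ q - p) (ℚₚ.+-inverseʳ p) (ℚₚ.+-monoˡ-≤ (- p) p≤q)

p≤q+r⇒p-q≤r : ∀ {p q r} → p ℚ.≤ q + r → p - q ℚ.≤ r
p≤q+r⇒p-q≤r {p} {q} {r} p≤q+r =
  subst (p - q ℚ.≤_) (solve 2 (λ q r → (q :+ r) :- q := r) refl q r) (ℚₚ.+-monoˡ-≤ (- q) p≤q+r)

+-cancelʳ-≤ : ∀ {p q} r → p + r ℚ.≤ q + r → p ℚ.≤ q
+-cancelʳ-≤ {p} {q} r h = subst₂ ℚ._≤_ (eq p r) (eq q r) (ℚₚ.+-monoˡ-≤ (- r) h)
  where
  eq : ∀ a b → (a + b) - b ≡ a
  eq = solve 2 (λ a b → (a :+ b) :- b := a) refl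

-- Taylor polynomials of the exponential function

-- The term yⁱ/i!, given by the ratio of consecutive terms, so that inductions on `i` meet neither
-- powers nor factorials.
expTerm : ℚ → ℕ → ℚ
expTerm y ℕ.zero    = 1ℚ
expTerm y (ℕ.suc i) = expTerm y i * y * (+ 1 / ℕ.suc i)

expSum : ℚ → ℕ → ℚ
expSum y ℕ.zero    = expTerm y 0
expSum y (ℕ.suc n) = expSum y n + expTerm y (ℕ.suc n)

expTerm-1 : ∀ i → expTerm 1ℚ i ≡ 1/[ i !]
expTerm-1 ℕ.zero    = refl
expTerm-1 (ℕ.suc i) = begin
  expTerm 1ℚ i * 1ℚ * (+ 1 / ℕ.suc i)  ≡⟨ cong (_* (+ 1 / ℕ.suc i)) (ℚₚ.*-identityʳ (expTerm 1ℚ i)) ⟩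
  expTerm 1ℚ i * (+ 1 / ℕ.suc i)       ≡⟨ cong (_* (+ 1 / ℕ.suc i)) (expTerm-1 i) ⟩
  1/[ i !] * (+ 1 / ℕ.suc i)           ≡⟨ ℚₚ.*-comm 1/[ i !] (+ 1 / ℕ.suc i) ⟩
  (+ 1 / ℕ.suc i) * 1/[ i !]           ≡⟨ *-/ 1 (ℕ.suc i) 1 (i ℕ.!) {{_}} {{i ℕₚ.!≢0}} ⟩
  1/[ ℕ.suc i !]                       ∎
  where open ≡-Reasoning

expSum-1 : ∀ n → expSum 1ℚ n ≡ Σ1/i! n
expSum-1 ℕ.zero    = refl
expSum-1 (ℕ.suc n) = cong₂ _+_ (expSum-1 n) (expTerm-1 (ℕ.suc n))

expSum-0 : ∀ n → expSum 0ℚ n ≡ 1ℚ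
expSum-0 ℕ.zero    = refl
expSum-0 (ℕ.suc n) = cong₂ _+_ (expSum-0 n)
  (trans (cong (_* (+ 1 / ℕ.suc n)) (ℚₚ.*-zeroʳ (expTerm 0ℚ n))) (ℚₚ.*-zeroˡ (+ 1 / ℕ.suc n)))

0≤expTerm : ∀ {y} i → 0ℚ ℚ.≤ y → 0ℚ ℚ.≤ expTerm y i
0≤expTerm ℕ.zero    0≤y = 0≤ι 1
0≤expTerm (ℕ.suc i) 0≤y = 0≤* (0≤* (0≤expTerm i 0≤y) 0≤y) (0≤1/n (ℕ.suc i))

expTerm-suc-*ι : ∀ y i → expTerm y (ℕ.suc i) * ι (ℕ.suc i) ≡ expTerm y i * y
expTerm-suc-*ι y i = begin
  expTerm y i * y * r * ι (ℕ.suc i)    ≡⟨ ℚₚ.*-assoc (expTerm y i * y) r (ι (ℕ.suc i)) ⟩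
  expTerm y i * y * (r * ι (ℕ.suc i))  ≡⟨ cong (expTerm y i * y *_) (trans (ℚₚ.*-comm r (ι (ℕ.suc i))) (ι*1/n≡1 (ℕ.suc i))) ⟩
  expTerm y i * y * 1ℚ                 ≡⟨ ℚₚ.*-identityʳ (expTerm y i * y) ⟩
  expTerm y i * y                      ∎
  where
  open ≡-Reasoning
  r = + 1 / ℕ.suc i

-- The mean value inequality for y ↦ yⁱ⁺¹/(i+1)!, whose derivative is yⁱ/i!.
expTerm-increment : ∀ {x y} i → 0ℚ ℚ.≤ x → 0ℚ ℚ.≤ y →
  expTerm (y + x) (ℕ.suc i) ℚ.≤ expTerm y (ℕ.suc i) + x * expTerm (y + x) i
expTerm-increment {x} {y} ℕ.zero 0≤x 0≤y = ℚₚ.≤-reflexive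
  (solve 2 (λ x y → con 1ℚ :* (y :+ x) :* con 1ℚ := con 1ℚ :* y :* con 1ℚ :+ x :* con 1ℚ) refl x y)
expTerm-increment {x} {y} (ℕ.suc i) 0≤x 0≤y = begin
  T′ * (y + x) * r
    ≡⟨ cong (_* r) (ℚₚ.*-distribˡ-+ T′ y x) ⟩
  (T′ * y + T′ * x) * r
    ≤⟨ *-monoʳ (0≤1/n (2 ℕ.+ i)) (ℚₚ.+-monoˡ-≤ (T′ * x) (*-monoʳ 0≤y (expTerm-increment i 0≤x 0≤y))) ⟩
  ((t′ + x * T) * y + T′ * x) * r
    ≡⟨ cong (_* r) (solve 5 (λ t′ x T y T′ → (t′ :+ x :* T) :* y :+ T′ :* x := t′ :* y :+ (x :* (T :* y) :+ T′ :* x)) refl t′ x T y T′) ⟩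
  (t′ * y + (x * (T * y) + T′ * x)) * r
    -- Enlarging `y` to `z` turns `T * y` into `T * z`, which equals `T′ * m`. The term `x * T′`
    -- then carries the total weight `(1ℚ + m) * r`, which is 1.
    ≤⟨ *-monoʳ (0≤1/n (2 ℕ.+ i)) (ℚₚ.+-monoʳ-≤ (t′ * y) (ℚₚ.+-monoˡ-≤ (T′ * x)
         (*-monoˡ 0≤x (*-monoˡ (0≤expTerm i 0≤z) y≤z)))) ⟩
  (t′ * y + (x * (T * z) + T′ * x)) * r
    ≡⟨ cong (λ w → (t′ * y + (x * w + T′ * x)) * r) (sym (expTerm-suc-*ι z i)) ⟩
  (t′ * y + (x * (T′ * m) + T′ * x)) * r
    ≡⟨ solve 6 (λ t′ y x T′ m r → (t′ :* y :+ (x :* (T′ :* m) :+ T′ :* x)) :* r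
                  := t′ :* y :* r :+ x :* (T′ :* ((con 1ℚ :+ m) :* r))) refl t′ y x T′ m r ⟩
  t′ * y * r + x * (T′ * ((1ℚ + m) * r))
    ≡⟨ cong (λ w → t′ * y * r + x * (T′ * w))
         (trans (cong (_* r) (sym (ι-suc (ℕ.suc i)))) (ι*1/n≡1 (2 ℕ.+ i))) ⟩
  t′ * y * r + x * (T′ * 1ℚ)
    ≡⟨ cong (λ w → t′ * y * r + x * w) (ℚₚ.*-identityʳ T′) ⟩
  t′ * y * r + x * T′ ∎
  where
  open ℚₚ.≤-Reasoning
  z  = y + x
  T  = expTerm z i
  T′ = expTerm z (ℕ.suc i)
  t′ = expTerm y (ℕ.suc i)
  r  = + 1 / (2 ℕ.+ i)
  m  = ι (ℕ.suc i)
  0≤z : 0ℚ ℚ.≤ z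
  0≤z = 0≤+ 0≤y 0≤x
  y≤z : y ℚ.≤ z
  y≤z = subst (ℚ._≤ z) (ℚₚ.+-identityʳ y) (ℚₚ.+-monoʳ-≤ y 0≤x)

-- Summing expTerm-increment leaves the top term x * expTerm (y + x) n over,
-- which has to stay on the left for the induction.
expSum-increment : ∀ {x y} n → 0ℚ ℚ.≤ x → 0ℚ ℚ.≤ y →
  expSum (y + x) n + x * expTerm (y + x) n ℚ.≤ expSum y n + x * expSum (y + x) n
expSum-increment ℕ.zero 0≤x 0≤y = ℚₚ.≤-refl
expSum-increment {x} {y} (ℕ.suc n) 0≤x 0≤y = begin
  E + T′ + x * T′
    ≤⟨ ℚₚ.+-monoˡ-≤ (x * T′) (ℚₚ.+-monoʳ-≤ E (expTerm-increment n 0≤x 0≤y)) ⟩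
  E + (t′ + x * T) + x * T′
    ≡⟨ solve 5 (λ E t′ x T T′ → E :+ (t′ :+ x :* T) :+ x :* T′ := (E :+ x :* T) :+ (t′ :+ x :* T′)) refl E t′ x T T′ ⟩
  (E + x * T) + (t′ + x * T′)
    ≤⟨ ℚₚ.+-monoˡ-≤ (t′ + x * T′) (expSum-increment n 0≤x 0≤y) ⟩
  (expSum y n + x * E) + (t′ + x * T′)
    ≡⟨ solve 5 (λ e E t′ x T′ → (e :+ x :* E) :+ (t′ :+ x :* T′) := (e :+ t′) :+ x :* (E :+ T′)) refl (expSum y n) E t′ x T′ ⟩
  (expSum y n + t′) + x * (E + T′) ∎
  where
  open ℚₚ.≤-Reasoning
  E  = expSum (y + x) n
  T  = expTerm (y + x) n
  T′ = expTerm (y + x) (ℕ.suc n)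
  t′ = expTerm y (ℕ.suc n)

expSum-decay : ∀ {x y} n → 0ℚ ℚ.≤ x → 0ℚ ℚ.≤ y → (1ℚ - x) * expSum (y + x) n ℚ.≤ expSum y n
expSum-decay {x} {y} n 0≤x 0≤y = begin
  (1ℚ - x) * E            ≡⟨ solve 2 (λ x E → (con 1ℚ :- x) :* E := E :- x :* E) refl x E ⟩
  E - x * E               ≤⟨ p≤q+r⇒p-q≤r (begin
    E                       ≡⟨ ℚₚ.+-identityʳ E ⟨
    E + 0ℚ                  ≤⟨ ℚₚ.+-monoʳ-≤ E (0≤* 0≤x (0≤expTerm n (0≤+ 0≤y 0≤x))) ⟩
    E + x * expTerm (y + x) n  ≤⟨ expSum-increment n 0≤x 0≤y ⟩
    expSum y n + x * E      ≡⟨ ℚₚ.+-comm (expSum y n) (x * E) ⟩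
    x * E + expSum y n      ∎) ⟩
  expSum y n              ∎
  where
  open ℚₚ.≤-Reasoning
  E = expSum (y + x) n

-- Each factor `1ℚ - x` pays for lowering the argument of `expSum` by `x`; after `k` of them the
-- argument is 0 and the sum is 1. The hypothesis x ≤ 1 keeps the remaining power nonnegative.
[1-x]^k*expSum≤1 : ∀ {x} k n → 0ℚ ℚ.≤ x → x ℚ.≤ 1ℚ → (1ℚ - x) ^ k * expSum (ι k * x) n ℚ.≤ 1ℚ
[1-x]^k*expSum≤1 {x} ℕ.zero n 0≤x x≤1 = ℚₚ.≤-reflexive
  (trans (ℚₚ.*-identityˡ _) (trans (cong (λ y → expSum y n) (ℚₚ.*-zeroˡ x)) (expSum-0 n)))
[1-x]^k*expSum≤1 {x} (ℕ.suc k) n 0≤x x≤1 = begin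
  (c * c ^ k) * expSum (ι (ℕ.suc k) * x) n
    ≡⟨ cong (λ y → (c * c ^ k) * expSum y n) (trans (cong (_* x) (ι-suc k))
         (solve 2 (λ a x → (con 1ℚ :+ a) :* x := a :* x :+ x) refl (ι k) x)) ⟩
  (c * c ^ k) * expSum (ι k * x + x) n
    ≡⟨ solve 3 (λ a b d → a :* b :* d := b :* (a :* d)) refl c (c ^ k) (expSum (ι k * x + x) n) ⟩
  c ^ k * (c * expSum (ι k * x + x) n)
    ≤⟨ *-monoˡ (0≤^ k (p≤q⇒0≤q-p x≤1)) (expSum-decay n 0≤x (0≤* (0≤ι k) 0≤x)) ⟩
  c ^ k * expSum (ι k * x) n
    ≤⟨ [1-x]^k*expSum≤1 k n 0≤x x≤1 ⟩
  1ℚ ∎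
  where
  open ℚₚ.≤-Reasoning
  c = 1ℚ - x

[1-1/k]^k*Σ1/i!≤1 : ∀ k n .{{_ : ℕ.NonZero k}} → (1ℚ - + 1 / k) ^ k * Σ1/i! n ℚ.≤ 1ℚ
[1-1/k]^k*Σ1/i!≤1 k n = subst (λ s → (1ℚ - + 1 / k) ^ k * s ℚ.≤ 1ℚ)
  (trans (cong (λ y → expSum y n) (ι*1/n≡1 k)) (expSum-1 n))
  ([1-x]^k*expSum≤1 k n (0≤1/n k) (1/n≤1 k))

-- Subsets of a finite set

elements : ∀ {n} → Subset n → List (Fin n)
elements []            = []
elements (inside ∷ p)  = zero ∷ map suc (elements p)
elements (outside ∷ p) = map suc (elements p)

length-elements : ∀ {n} (p : Subset n) → length (elements p) ≡ ∣ p ∣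
length-elements []            = refl
length-elements (inside ∷ p)  = cong ℕ.suc (trans (length-map suc (elements p)) (length-elements p))
length-elements (outside ∷ p) = trans (length-map suc (elements p)) (length-elements p)

∈-elements⁺ : ∀ {n x} {p : Subset n} → x ∈ p → x List.∈ elements p
∈-elements⁺ {p = inside ∷ p}  Vec.here        = here refl
∈-elements⁺ {p = inside ∷ p}  (Vec.there x∈p) = there (∈-map⁺ suc (∈-elements⁺ x∈p))
∈-elements⁺ {p = outside ∷ p} (Vec.there x∈p) = ∈-map⁺ suc (∈-elements⁺ x∈p)

∈-elements⁻ : ∀ {n x} (p : Subset n) → x List.∈ elements p → x ∈ p
∈-elements⁻ (inside ∷ p) (here refl) = Vec.here
∈-elements⁻ (inside ∷ p) (there x∈) with ∈-map⁻ suc x∈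
... | _ , y∈ , refl = Vec.there (∈-elements⁻ p y∈)
∈-elements⁻ (outside ∷ p) x∈ with ∈-map⁻ suc x∈
... | _ , y∈ , refl = Vec.there (∈-elements⁻ p y∈)

-- The tail goes in first, so the head of the list is added to an already enlarged set. That is the
-- situation in which submodularity compares gains.
insertAll : ∀ {n} → Subset n → List (Fin n) → Subset n
insertAll = foldr λ u p → p ∪ ⁅ u ⁆

⊆-insertAll : ∀ {n} (p : Subset n) us → p ⊆ insertAll p us
⊆-insertAll p []       x∈p = x∈p
⊆-insertAll p (u ∷ us) x∈p = p⊆p∪q ⁅ u ⁆ (⊆-insertAll p us x∈p)

∈-insertAll : ∀ {n x} (p : Subset n) {us} → x List.∈ us → x ∈ insertAll p us
∈-insertAll p {u ∷ us} (here refl) = q⊆p∪q (insertAll p us) ⁅ u ⁆ (x∈⁅x⁆ u)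
∈-insertAll p {u ∷ us} (there x∈) = p⊆p∪q ⁅ u ⁆ (∈-insertAll p x∈)

∪-least : ∀ {n} {p q r : Subset n} → p ⊆ r → q ⊆ r → p ∪ q ⊆ r
∪-least {p = p} {q} p⊆r q⊆r x∈ = [ p⊆r , q⊆r ]′ (x∈p∪q⁻ p q x∈)

-- The algorithm returns `M ─ D`, while its contribution is measured after adding `D` back; this
-- recovers `M`.
p⊆q⇒p∪[q─p]≡q : ∀ {n} {p q : Subset n} → p ⊆ q → p ∪ (q ─ p) ≡ q
p⊆q⇒p∪[q─p]≡q {p = p} {q} p⊆q = ⊆-antisym (∪-least p⊆q (p─q⊆p q p)) q⊆
  where
  q⊆ : q ⊆ p ∪ (q ─ p)
  q⊆ {x} x∈q with x ∈? p
  ... | yes x∈p = p⊆p∪q (q ─ p) x∈p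
  ... | no  x∉p = q⊆p∪q p (q ─ p) (x∈p∧x∉q⇒x∈p─q x∈q x∉p)

-- Ensures that the maximum over the k-element subsets of `C` is not taken over an empty family.
∃-subset-of-size : ∀ {n} (p : Subset n) k → k ≤ ∣ p ∣ → ∃[ q ] q ⊆ p × ∣ q ∣ ≡ k
∃-subset-of-size {n} p ℕ.zero _ = ⊥ , ⊥⊆ , ∣⊥∣≡0 n
∃-subset-of-size (inside ∷ p) (ℕ.suc k) (ℕ.s≤s k≤) with ∃-subset-of-size p k k≤
... | q , q⊆p , ∣q∣≡k = inside ∷ q , s⊆s q⊆p , cong ℕ.suc ∣q∣≡k
∃-subset-of-size (outside ∷ p) (ℕ.suc k) k≤ with ∃-subset-of-size p (ℕ.suc k) k≤
... | q , q⊆p , ∣q∣≡k = outside ∷ q , out⊆ q⊆p , ∣q∣≡k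

-- Maximizers over the subsets of a finite set

module _ {n : ℕ} (P : Subset n → Set) (f : Subset n → ℚ) where

  Maximizer : Subset n → Set
  Maximizer p = P p × (∀ q → P q → f q ℚ.≤ f p)

-- Exhaustive search, splitting on whether the first element is a member and comparing the best
-- subsets of the two halves.
maximizer? : ∀ {n} {P : Subset n → Set} (P? : Decidable P) (f : Subset n → ℚ) →
             (∃[ p ] Maximizer P f p) ⊎ (∀ p → ¬ P p)
maximizer? {ℕ.zero} P? f with P? []
... | yes P[] = inj₁ ([] , P[] , λ { [] _ → ℚₚ.≤-refl })
... | no ¬P[] = inj₂ λ { [] → ¬P[] }
maximizer? {ℕ.suc n} P? f
  with maximizer? (λ p → P? (inside ∷ p)) (λ p → f (inside ∷ p))
     | maximizer? (λ p → P? (outside ∷ p)) (λ p → f (outside ∷ p))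
... | inj₂ ¬in | inj₂ ¬out =
      inj₂ λ { (inside ∷ p) → ¬in p ; (outside ∷ p) → ¬out p }
... | inj₁ (p , Pp , max) | inj₂ ¬out =
      inj₁ (inside ∷ p , Pp , λ { (inside ∷ q) Pq → max q Pq ; (outside ∷ q) Pq → ⊥-elim (¬out q Pq) })
... | inj₂ ¬in | inj₁ (p , Pp , max) =
      inj₁ (outside ∷ p , Pp , λ { (inside ∷ q) Pq → ⊥-elim (¬in q Pq) ; (outside ∷ q) Pq → max q Pq })
... | inj₁ (p , Pp , max) | inj₁ (p′ , Pp′ , max′) with ℚₚ.≤-total (f (inside ∷ p)) (f (outside ∷ p′))
...   | inj₁ ≤′ = inj₁ (outside ∷ p′ , Pp′ ,
          λ { (inside ∷ q) Pq → ℚₚ.≤-trans (max q Pq) ≤′ ; (outside ∷ q) Pq → max′ q Pq })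
...   | inj₂ ≥′ = inj₁ (inside ∷ p , Pp ,
          λ { (inside ∷ q) Pq → max q Pq ; (outside ∷ q) Pq → ℚₚ.≤-trans (max′ q Pq) ≥′ })

-- Gains of monotone submodular set functions

-- Monotonicity is the case p = s, r = p; submodularity the case p = q ∩ r, s = q ∪ r.
MonotoneSubmodular : ∀ {n} → (Subset n → ℚ) → Set
MonotoneSubmodular f = ∀ p q r s → p ⊆ q → p ⊆ r → s ⊆ q ∪ r → f s + f p ℚ.≤ f q + f r

module _ {n : ℕ} (f : Subset n → ℚ) (f-sub : MonotoneSubmodular f) where

  mono : ∀ {p q} → p ⊆ q → f p ℚ.≤ f q
  mono {p} {q} p⊆q = +-cancelʳ-≤ (f p) (f-sub p q p p p⊆q (λ x∈p → x∈p) (q⊆p∪q q p))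

  -- The total gain telescopes into single insertions, and by diminishing returns each of them gains
  -- no more than the same insertion into `p`.
  insertAll-bound : ∀ {p δ} us → (∀ {u} → u List.∈ us → f (p ∪ ⁅ u ⁆) - f p ℚ.≤ δ) →
                    f (insertAll p us) ℚ.≤ f p + ι (length us) * δ
  insertAll-bound {p} {δ} [] _ =
    ℚₚ.≤-reflexive (solve 2 (λ a d → a := a :+ con 0ℚ :* d) refl (f p) δ)
  insertAll-bound {p} {δ} (u ∷ us) gain≤δ = +-cancelʳ-≤ (f p) (begin
    f (q ∪ ⁅ u ⁆) + f p
      -- Diminishing returns: adding `u` to the larger set `q` gains at most what adding it to `p`
      -- gains.
      ≤⟨ f-sub p (p ∪ ⁅ u ⁆) q (q ∪ ⁅ u ⁆) (p⊆p∪q ⁅ u ⁆) (⊆-insertAll p us)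
           (∪-least (q⊆p∪q (p ∪ ⁅ u ⁆) q) (λ x∈ → p⊆p∪q q (q⊆p∪q p ⁅ u ⁆ x∈))) ⟩
    f (p ∪ ⁅ u ⁆) + f q
      ≡⟨ solve 3 (λ a b c → a :+ b := b :+ (a :- c) :+ c) refl (f (p ∪ ⁅ u ⁆)) (f q) (f p) ⟩
    f q + (f (p ∪ ⁅ u ⁆) - f p) + f p
      ≤⟨ ℚₚ.+-monoˡ-≤ (f p) (ℚₚ.+-mono-≤ (insertAll-bound us (λ u∈ → gain≤δ (there u∈))) (gain≤δ (here refl))) ⟩
    f p + m * δ + δ + f p
      ≡⟨ cong (_+ f p) (solve 3 (λ a m d → a :+ m :* d :+ d := a :+ (con 1ℚ :+ m) :* d) refl (f p) m δ) ⟩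
    f p + (1ℚ + m) * δ + f p
      ≡⟨ cong (λ w → f p + w * δ + f p) (ι-suc (length us)) ⟨
    f p + ι (ℕ.suc (length us)) * δ + f p ∎)
    where
    open ℚₚ.≤-Reasoning
    q = insertAll p us
    m = ι (length us)

  union-bound : ∀ {p q δ} → (∀ {u} → u ∈ q → f (p ∪ ⁅ u ⁆) - f p ℚ.≤ δ) →
                f (p ∪ q) ℚ.≤ f p + ι ∣ q ∣ * δ
  union-bound {p} {q} {δ} gain≤δ = begin
    -- By monotonicity an inclusion into the set built element by element suffices; equality of the
    -- two sets need not be shown.
    f (p ∪ q)                         ≤⟨ mono (∪-least (⊆-insertAll p (elements q)) (λ x∈q → ∈-insertAll p (∈-elements⁺ x∈q))) ⟩
    f (insertAll p (elements q))      ≤⟨ insertAll-bound (elements q) (λ u∈ → gain≤δ (∈-elements⁻ q u∈)) ⟩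
    f p + ι (length (elements q)) * δ ≡⟨ cong (λ m → f p + ι m * δ) (length-elements q) ⟩
    f p + ι ∣ q ∣ * δ                 ∎
    where open ℚₚ.≤-Reasoning

-- Group betweenness centrality is monotone and submodular

indicator : ∀ {P : Set} → Dec P → ℕ
indicator (yes _) = 1
indicator (no _)  = 0

-- When `P` holds, both summands on the right are 1; when only `S` holds, at least one of them is.
indicator-submodular : ∀ {P Q R S : Set} (P? : Dec P) (Q? : Dec Q) (R? : Dec R) (S? : Dec S) →
  (P → Q × R) → (S → Q ⊎ R) → indicator S? ℕ.+ indicator P? ≤ indicator Q? ℕ.+ indicator R?
indicator-submodular (yes p) (no ¬q) _       _       P⇒ _ = ⊥-elim (¬q (proj₁ (P⇒ p)))
indicator-submodular (yes p) (yes _) (no ¬r) _       P⇒ _ = ⊥-elim (¬r (proj₂ (P⇒ p)))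
indicator-submodular (yes _) (yes _) (yes _) (yes _) _  _ = ℕₚ.≤-refl
indicator-submodular (yes _) (yes _) (yes _) (no _)  _  _ = ℕ.s≤s ℕ.z≤n
indicator-submodular (no _)  _       _       (no _)  _  _ = ℕ.z≤n
indicator-submodular (no _)  (yes _) _       (yes _) _  _ = ℕ.s≤s ℕ.z≤n
indicator-submodular (no _)  (no _)  (yes _) (yes _) _  _ = ℕₚ.≤-refl
indicator-submodular (no _)  (no ¬q) (no ¬r) (yes s) _ S⇒ = ⊥-elim ([ ¬q , ¬r ]′ (S⇒ s))

module _ {A : Set} where

  length-filter-∷ : ∀ {P : Pred A 0ℓ} (P? : Decidable P) x xs →
    length (filter P? (x ∷ xs)) ≡ indicator (P? x) ℕ.+ length (filter P? xs)
  length-filter-∷ P? x xs with P? x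
  ... | yes _ = refl
  ... | no  _ = refl

  length-filter-submodular : ∀ {P Q R S : Pred A 0ℓ}
    (P? : Decidable P) (Q? : Decidable Q) (R? : Decidable R) (S? : Decidable S) →
    (∀ {x} → P x → Q x × R x) → (∀ {x} → S x → Q x ⊎ R x) → ∀ xs →
    length (filter S? xs) ℕ.+ length (filter P? xs) ≤ length (filter Q? xs) ℕ.+ length (filter R? xs)
  length-filter-submodular P? Q? R? S? P⇒ S⇒ []       = ℕ.z≤n
  length-filter-submodular P? Q? R? S? P⇒ S⇒ (x ∷ xs) = begin
    length (filter S? (x ∷ xs)) ℕ.+ length (filter P? (x ∷ xs))
      ≡⟨ split S? P? ⟩
    (indicator (S? x) ℕ.+ indicator (P? x)) ℕ.+ (length (filter S? xs) ℕ.+ length (filter P? xs))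
      ≤⟨ ℕₚ.+-mono-≤ (indicator-submodular (P? x) (Q? x) (R? x) (S? x) P⇒ S⇒)
                     (length-filter-submodular P? Q? R? S? P⇒ S⇒ xs) ⟩
    (indicator (Q? x) ℕ.+ indicator (R? x)) ℕ.+ (length (filter Q? xs) ℕ.+ length (filter R? xs))
      ≡⟨ split Q? R? ⟨
    length (filter Q? (x ∷ xs)) ℕ.+ length (filter R? (x ∷ xs)) ∎
    where
    open ℕₚ.≤-Reasoning
    open import Algebra.Properties.CommutativeSemigroup ℕₚ.+-commutativeSemigroup using (interchange)
    split : ∀ {T U : Pred A 0ℓ} (T? : Decidable T) (U? : Decidable U) →
      length (filter T? (x ∷ xs)) ℕ.+ length (filter U? (x ∷ xs)) ≡
      (indicator (T? x) ℕ.+ indicator (U? x)) ℕ.+ (length (filter T? xs) ℕ.+ length (filter U? xs))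
    split T? U? = trans (cong₂ ℕ._+_ (length-filter-∷ T? x xs) (length-filter-∷ U? x xs))
      (interchange (indicator (T? x)) (length (filter T? xs)) (indicator (U? x)) (length (filter U? xs)))

module _ {n : ℕ} (G : Graph n) where

  fraction-+-mono : ∀ {a b c d} m → a ℕ.+ b ≤ c ℕ.+ d →
    fraction G a m + fraction G b m ℚ.≤ fraction G c m + fraction G d m
  -- With denominator 0, the case of a pair without shortest paths, every fraction is 0 by
  -- convention.
  fraction-+-mono ℕ.zero _ = ℚₚ.≤-refl
  fraction-+-mono {a} {b} {c} {d} m@(ℕ.suc _) h =
    subst₂ ℚ._≤_ (sym (+-/ a b m)) (sym (+-/ c d m)) (/-mono-≤ m h)

  sumℚ-+-mono : ∀ {A : Set} {f g h k : A → ℚ} → (∀ x → f x + g x ℚ.≤ h x + k x) → ∀ xs →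
    sumℚ G (map f xs) + sumℚ G (map g xs) ℚ.≤ sumℚ G (map h xs) + sumℚ G (map k xs)
  sumℚ-+-mono hyp [] = ℚₚ.≤-refl
  sumℚ-+-mono {f = f} {g} {h} {k} hyp (x ∷ xs) =
    subst₂ ℚ._≤_ (interchange (f x) (g x) _ _) (interchange (h x) (k x) _ _)
      (ℚₚ.+-mono-≤ (hyp x) (sumℚ-+-mono hyp xs))
    where
    interchange : ∀ a b c d → (a + b) + (c + d) ≡ (a + c) + (b + d)
    interchange = solve 4 (λ a b c d → (a :+ b) :+ (c :+ d) := (a :+ c) :+ (b :+ d)) refl

  Traverses-∪⁻ : ∀ {q r s p} → s ⊆ q ∪ r → Traverses G s p → Traverses G q p ⊎ Traverses G r p
  Traverses-∪⁻ {q} {r} s⊆ (here x∈) = [ (λ x∈q → inj₁ (here x∈q)) , (λ x∈r → inj₂ (here x∈r)) ]′ (x∈p∪q⁻ q r (s⊆ x∈))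
  Traverses-∪⁻ s⊆ (there t) = [ (λ t → inj₁ (there t)) , (λ t → inj₂ (there t)) ]′ (Traverses-∪⁻ s⊆ t)

  -- Holds path by path: a path meeting `p` meets both `q` and `r`, and a path meeting `s` meets `q`
  -- or `r`. Counting the shortest paths of a pair, dividing by their number and summing over pairs
  -- preserve the inequality.
  GBC-submodular : MonotoneSubmodular (GBC G)
  GBC-submodular p q r s p⊆q p⊆r s⊆q∪r = sumℚ-+-mono
    (λ (u , v) → fraction-+-mono (σ G u v)
      (length-filter-submodular (traverses? G p) (traverses? G q) (traverses? G r) (traverses? G s)
        (λ t → Any.map p⊆q t , Any.map p⊆r t) (Traverses-∪⁻ s⊆q∪r) (shortestPaths G u v)))
    (distinctPairs G)

  -- The greedy run and its gap to the optimum

  SecondPhase-⊆ : ∀ {C k M M′} → SecondPhase G C k M M′ → M ⊆ M′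
  SecondPhase-⊆ stop                     = λ x∈ → x∈
  SecondPhase-⊆ (step v v∈C max rest) x∈ = SecondPhase-⊆ rest (p⊆p∪q ⁅ v ⁆ x∈)

  greedy-step : ∀ {C M D X v} k .{{_ : ℕ.NonZero k}} → D ⊆ M → X ⊆ C → ∣ X ∣ ≡ k →
    (∀ u → u ∈ C → BC^ G M u ℚ.≤ BC^ G M v) →
    GBC G (D ∪ X) - GBC G (M ∪ ⁅ v ⁆) ℚ.≤ (1ℚ - + 1 / k) * (GBC G (D ∪ X) - GBC G M)
  greedy-step {C} {M} {D} {X} {v} k D⊆M X⊆C ∣X∣≡k max = begin
    F - g⁺                  ≡⟨ solve 3 (λ F g g⁺ → F :- g⁺ := (F :- g) :- (g⁺ :- g)) refl F g g⁺ ⟩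
    (F - g) - δ             ≤⟨ ℚₚ.+-monoʳ-≤ (F - g) (ℚₚ.neg-antimono-≤ average≤δ) ⟩
    (F - g) - x * (F - g)   ≡⟨ solve 2 (λ a x → a :- x :* a := (con 1ℚ :- x) :* a) refl (F - g) x ⟩
    (1ℚ - x) * (F - g)      ∎
    where
    open ℚₚ.≤-Reasoning
    F  = GBC G (D ∪ X)
    g  = GBC G M
    g⁺ = GBC G (M ∪ ⁅ v ⁆)
    δ  = g⁺ - g
    x  = + 1 / k
    F-g≤kδ : F - g ℚ.≤ ι k * δ
    F-g≤kδ = p≤q+r⇒p-q≤r (begin
      F                  ≤⟨ mono (GBC G) GBC-submodular (∪-least (λ y∈ → p⊆p∪q X (D⊆M y∈)) (q⊆p∪q M X)) ⟩
      -- The greedy choice `v` beats every vertex of `X` because `max` ranges over all of `C`,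
      -- including vertices already in `M`.
      GBC G (M ∪ X)      ≤⟨ union-bound (GBC G) GBC-submodular (λ {u} u∈X → max u (X⊆C u∈X)) ⟩
      g + ι ∣ X ∣ * δ    ≡⟨ cong (λ m → g + ι m * δ) ∣X∣≡k ⟩
      g + ι k * δ        ∎)
    average≤δ : x * (F - g) ℚ.≤ δ
    average≤δ = begin
      x * (F - g)      ≤⟨ *-monoˡ (0≤1/n k) F-g≤kδ ⟩
      x * (ι k * δ)    ≡⟨ solve 3 (λ x k d → x :* (k :* d) := (k :* x) :* d) refl x (ι k) δ ⟩
      (ι k * x) * δ    ≡⟨ cong (_* δ) (ι*1/n≡1 k) ⟩
      1ℚ * δ           ≡⟨ ℚₚ.*-identityˡ δ ⟩
      δ                ∎

  -- The size `k` of the competitor `X` fixes the rate, and `j` counts the remaining rounds; keeping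
  -- them apart lets `j` decrease in the induction while the factor stays the same. The first set
  -- `D` also stays fixed while `M` grows.
  greedy-decay : ∀ {C M M′ D X} k j .{{_ : ℕ.NonZero k}} → D ⊆ M → X ⊆ C → ∣ X ∣ ≡ k →
    SecondPhase G C j M M′ →
    GBC G (D ∪ X) - GBC G M′ ℚ.≤ (1ℚ - + 1 / k) ^ j * (GBC G (D ∪ X) - GBC G M)
  greedy-decay {M = M} {D = D} {X} k ℕ.zero D⊆M X⊆C ∣X∣≡k stop =
    ℚₚ.≤-reflexive (sym (ℚₚ.*-identityˡ (GBC G (D ∪ X) - GBC G M)))
  greedy-decay {M = M} {M′} {D} {X} k (ℕ.suc j) D⊆M X⊆C ∣X∣≡k (step v v∈C max rest) = begin
    F - GBC G M′                    ≤⟨ greedy-decay k j (λ x∈ → p⊆p∪q ⁅ v ⁆ (D⊆M x∈)) X⊆C ∣X∣≡k rest ⟩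
    c ^ j * (F - GBC G (M ∪ ⁅ v ⁆)) ≤⟨ *-monoˡ (0≤^ j (p≤q⇒0≤q-p (1/n≤1 k))) (greedy-step k D⊆M X⊆C ∣X∣≡k max) ⟩
    c ^ j * (c * (F - GBC G M))     ≡⟨ solve 3 (λ a b d → a :* (b :* d) := (b :* a) :* d) refl (c ^ j) c (F - GBC G M) ⟩
    c * c ^ j * (F - GBC G M)       ∎
    where
    open ℚₚ.≤-Reasoning
    F = GBC G (D ∪ X)
    c = 1ℚ - + 1 / k

  greedy-bound : ∀ {C D R X} k n .{{_ : ℕ.NonZero k}} → X ⊆ C → ∣ X ∣ ≡ k → Returns G D C k R →
    seq 1-1/e n * GBC^ G D X ℚ.≤ GBC^ G D R
  greedy-bound {C} {D} {R} {X} k n X⊆C ∣X∣≡k (M , run , refl) = begin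
    -- `seq 1-1/e n` unfolds to `1ℚ - i`: the bound in `e-positive` starts at index 0, so the
    -- reciprocal does not shift the sequence.
    (1ℚ - i) * opt                            ≡⟨ solve 2 (λ i a → (con 1ℚ :- i) :* a := a :- i :* a) refl i opt ⟩
    opt - i * opt                             ≤⟨ ℚₚ.+-monoʳ-≤ opt (ℚₚ.neg-antimono-≤ gap≤) ⟩
    opt - (F - GBC G M)                       ≡⟨ solve 3 (λ F d m → (F :- d) :- (F :- m) := m :- d) refl F (GBC G D) (GBC G M) ⟩
    GBC G M - GBC G D                         ≡⟨ cong (λ p → GBC G p - GBC G D) (p⊆q⇒p∪[q─p]≡q (SecondPhase-⊆ run)) ⟨
    GBC G (D ∪ (M ─ D)) - GBC G D             ∎
    where
    open ℚₚ.≤-Reasoning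
    F   = GBC G (D ∪ X)
    opt = GBC^ G D X
    c   = 1ℚ - + 1 / k
    E   = Σ1/i! n
    0<E : 0ℚ ℚ.< E
    0<E = ℚₚ.<-≤-trans (proj₁ (proj₂ e-positive)) (proj₂ (proj₂ (proj₂ e-positive)) n ℕ.z≤n)
    i   = (1/ E) {{>-nonZero 0<E}}
    0≤i : 0ℚ ℚ.≤ i
    0≤i = ℚₚ.<⇒≤ (ℚₚ.positive⁻¹ i {{ℚₚ.1/pos⇒pos E {{ℚ.positive 0<E}}}})
    cᵏ≤i : c ^ k ℚ.≤ i
    cᵏ≤i = begin
      c ^ k            ≡⟨ ℚₚ.*-identityʳ (c ^ k) ⟨
      c ^ k * 1ℚ       ≡⟨ cong (c ^ k *_) (ℚₚ.*-inverseʳ E {{>-nonZero 0<E}}) ⟨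
      c ^ k * (E * i)  ≡⟨ ℚₚ.*-assoc (c ^ k) E i ⟨
      c ^ k * E * i    ≤⟨ *-monoʳ 0≤i ([1-1/k]^k*Σ1/i!≤1 k n) ⟩
      1ℚ * i           ≡⟨ ℚₚ.*-identityˡ i ⟩
      i                ∎
    gap≤ : F - GBC G M ℚ.≤ i * opt
    gap≤ = begin
      -- The run starts from `D`, so the initial gap is exactly `opt`, and it lasts as many rounds
      -- as `X` has elements.
      F - GBC G M      ≤⟨ greedy-decay k k (λ x∈ → x∈) X⊆C ∣X∣≡k run ⟩
      -- Monotonicity makes `opt` nonnegative, which allows its coefficient to be enlarged.
      c ^ k * opt      ≤⟨ *-monoʳ (p≤q⇒0≤q-p (mono (GBC G) GBC-submodular (p⊆p∪q X))) cᵏ≤i ⟩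
      i * opt          ∎

-- Existence of the optimum and passage to the reals

proposition3 : ∀ {n : ℕ} (G : Graph n) (D C : Subset n) (k : ℕ) →
    Empty (C ∩ D) → 1 ≤ k → k ≤ ∣ C ∣ →
    ∀ (R : Subset n) → Returns G D C k R →
    ∃[ opt ] IsMaxContribution G D C k opt ×
    (fromℚ (GBC^ G D R) ≥ᴿ 1-1/e *ᴿ fromℚ opt)
proposition3 G D C k _ 1≤k k≤∣C∣ R returns
  with maximizer? (λ X → (X ⊆? C) ×-dec (∣ X ∣ ℕₚ.≟ k)) (GBC^ G D)
... | inj₂ none = let (X , X⊆C , ∣X∣≡k) = ∃-subset-of-size C k k≤∣C∣
                  in ⊥-elim (none X (X⊆C , ∣X∣≡k))
... | inj₁ (X , (X⊆C , ∣X∣≡k) , max) =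
  GBC^ G D X ,
  ((X , X⊆C , ∣X∣≡k , refl) , λ M′ M′⊆C ∣M′∣≡k → max M′ (M′⊆C , ∣M′∣≡k)) ,
  -- The rational inequality holds at every index, so the threshold 0 serves for each `ε`, and `ε`
  -- is mere slack.
  λ ε 0<ε → 0 , λ n _ → ℚₚ.≤-trans (greedy-bound G k n {{ℕ.>-nonZero 1≤k}} X⊆C ∣X∣≡k returns)
    (subst (ℚ._≤ GBC^ G D R + ε) (ℚₚ.+-identityʳ (GBC^ G D R)) (ℚₚ.+-monoʳ-≤ (GBC^ G D R) (ℚₚ.<⇒≤ 0<ε)))
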